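{- Let $r\ge 2$, $n=2^r$, $\nu=2^{r-1}-1$. (1) If $\mathcal{C}$ is a zeroed NP1CC of length $n$ of Type B, or a zeroed NP1CC of length $n$ of Type C that contains a codeword of weight two, then $A_0(\mathcal{C})=1$ and for $1\le i\le n$, $$A_i(\mathcal{C})=\frac{\binom{n}{i}+(n-1)\Delta_i-\Delta_{i-1}}{n}.$$ (2) If $\mathcal{C}$ is a translate of an NP1CC of length $n$ of Type B, or a translate of an NP1CC of length $n$ of Type C, and $\mathcal{C}$ contains two codewords of weight one, then $A_0(\mathcal{C})=0$, $A_1(\mathcal{C})=2$, and for $i\ge 2$, $$A_i(\mathcal{C})=\frac{\binom{n}{i}+(n-1)\Delta_{i-1}-\Delta_i}{n}.$$
   Context: All codes are binary; $A_i(\mathcal{C})$ is the number of codewords of $\mathcal{C}$ of Hamming weight $i$. A code is zeroed if it contains the all-zero word. A translate of $\mathcal{C}$ is $\mathbf{x}+\mathcal{C}=\{\mathbf{x}+\mathbf{c}:\mathbf{c}\in\mathcal{C}\}$. An NP1CC of length $n=2^r$ is a code $\mathcal{C}\subseteq\mathbb{F}_2^n$ with $|\mathcal{C}|=2^{n-r}$ such that every word of $\mathbb{F}_2^n$ is at distance at most $1$ from some codeword. In an NP1CC every codeword $\mathbf{c}$ has exactly one other codeword $\mathbf{c}'$ (its partner) with $d(\mathbf{c},\mathbf{c}')\in\{1,2\}$. The NP1CC is of Type A if every partner is at distance $1$, Type B if every partner is at distance $2$, Type C otherwise. For integers $i\ge 0$: $\Delta_i=\binom{\nu}{\lfloor i/2\rfloor}$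 if $i\equiv 0,3\pmod 4$ and $\Delta_i=-\binom{\nu}{\lfloor i/2\rfloor}$ if $i\equiv 1,2\pmod 4$ (with $\binom{a}{b}=0$ for $b>a$). -}

module Defs where

open import Data.Bool using (Bool; true; false; if_then_else_; _xor_; _∧_)
open import Data.Nat using (ℕ; zero; suc; _+_; _*_; _∸_; _^_; _/_; _%_; _≡ᵇ_)
open import Data.Nat.Combinatorics using () renaming (_C_ to _choose_)
open import Data.Integer as ℤ using (ℤ; +_; -_)
open import Data.List using (List; []; _∷_; map; _++_)
open import Data.Nat.ListAction using (sum)
open import Data.Vec using (Vec; []; _∷_; zipWith; replicate)
open import Data.Product using (Σ; _×_; _,_; ∃)
open import Data.Sum using (_⊎_)
open import Relation.Binary.PropositionalEquality using (_≡_; _≢_)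
open import Relation.Nullary using (¬_)

Word : ℕ → Set
Word n = Vec Bool n

Code : ℕ → Set
Code n = Word n → Bool

_∈C_ : ∀ {n} → Word n → Code n → Set
w ∈C C = C w ≡ true

allWords : (n : ℕ) → List (Word n)
allWords zero = [] ∷ []
allWords (suc n) = map (false ∷_) (allWords n) ++ map (true ∷_) (allWords n)

count : ∀ {n} → (Word n → Bool) → ℕ
count {n} p = sum (map (λ w → if p w then 1 else 0) (allWords n))

weight : ∀ {n} → Word n → ℕ
weight [] = 0
weight (false ∷ w) = weight w
weight (true ∷ w) = suc (weight w)

_⊕_ : ∀ {n} → Word n → Word n → Word n
_⊕_ = zipWith _xor_

dist : ∀ {n} → Word n → Word n → ℕ
dist u v = weight (u ⊕ v)

zeroWord : ∀ {n} → Word n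
zeroWord = replicate _ false

size : ∀ {n} → Code n → ℕ
size C = count C

A : ∀ {n} → ℕ → Code n → ℕ
A i C = count (λ w → C w ∧ (weight w ≡ᵇ i))

Zeroed : ∀ {n} → Code n → Set
Zeroed C = zeroWord ∈C C

NP1CC : (r : ℕ) → Code (2 ^ r) → Set
NP1CC r C = (size C ≡ 2 ^ (2 ^ r ∸ r))
          × (∀ (x : Word (2 ^ r)) → ∃ λ c → c ∈C C × (dist x c ≡ 0 ⊎ dist x c ≡ 1))

IsPartner : ∀ {n} → Code n → Word n → Word n → Set
IsPartner C c c' = c' ∈C C × c' ≢ c × (dist c c' ≡ 1 ⊎ dist c c' ≡ 2)

TypeA : ∀ {n} → Code n → Set
TypeA C = ∀ c c' → c ∈C C → IsPartner C c c' → dist c c' ≡ 1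

TypeB : ∀ {n} → Code n → Set
TypeB C = ∀ c c' → c ∈C C → IsPartner C c c' → dist c c' ≡ 2

TypeC : ∀ {n} → Code n → Set
TypeC C = ¬ TypeA C × ¬ TypeB C

IsTranslate : ∀ {n} → Code n → Code n → Set
IsTranslate {n} C D = ∃ λ (x : Word n) → ∀ w → C w ≡ D (w ⊕ x)

Δ : (ν i : ℕ) → ℤ
Δ ν i with i % 4
... | 0 = + (ν choose (i / 2))
... | 3 = + (ν choose (i / 2))
... | _ = - (+ (ν choose (i / 2)))

binom : ℕ → ℕ → ℕ
binom = _choose_

{-# OPTIONS --safe #-}

-- Let B sum a function over the balls of radius 1 and let χ be the indicator of an NP1CC. Then
-- Bχ = 1 + f with excess f ≥ 0 and Σ f = |C|. As n is even, Bf is odd off C and even on C, and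
-- double counting Σ (1 − χ) Bf = Σ f B(1 − χ) forces f ≤ 1 and Bf = 1 off C; on C the value Bf = 0
-- is excluded because 3 does not divide n², and a second count gives Bf = 1 + χ. The equations
-- Bχ = 1 + f, Bf = 1 + χ are coupled recurrences for the distance distributions of χ and f around
-- any word, with a unique solution for given values at that word. The two parts of the theorem are
-- the values (χ, f) = (1, 0) and (0, 1); the numbers Δ enter as the coefficients of
-- (1 − x)(1 − x²)^ν.

module Submission where

open import Defs
open import Algebra.Bundles using (AbelianGroup)
import Algebra.Properties.Group
open import Data.Bool using (Bool; true; false; not; _∧_; if_then_else_)
open import Data.Bool.Properties using (∧-zeroʳ; ∧-identityʳ)
import Data.Integer.Properties as ℤₚ
import Data.Integer.Tactic.RingSolver as ℤSolver
open import Data.List using (map; _++_)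
open import Data.List.Properties using (map-++; map-∘)
open import Data.Nat using (ℕ; zero; suc; _≤_; _∸_; _^_; z≤n; s≤s)
import Data.Nat as ℕ
open import Data.Nat.Combinatorics using (nCk+nC[k+1]≡[n+1]C[k+1]; nC1≡n)
open import Data.Nat.Divisibility using (_∣_; _∣?_; divides; m∣m*n; ∣m+n∣m⇒∣n)
open import Data.Nat.DivMod using (_/_; _%_; m%n<n; m/n≡1+[m∸n]/n)
open import Data.Nat.ListAction using (sum)
open import Data.Nat.ListAction.Properties using (sum-++)
open import Data.Nat.Primality using (prime?; euclidsLemma)
import Data.Nat.Properties as ℕₚ
import Data.Nat.Tactic.RingSolver as ℕSolver
open import Data.Product using (_×_; ∃; Σ; _,_; proj₁; proj₂)
open import Data.Sum using (_⊎_; inj₁; inj₂)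
open import Data.Vec using ([]; _∷_)
open import Function using (_∘_; _$_)
open import Relation.Binary.PropositionalEquality
open import Relation.Nullary using (¬_; contradiction)
open import Relation.Nullary.Decidable using (from-yes; from-no)

-- The covering condition yields only Bχ = 1 + f, and a recurrence for χ does not close while f is
-- unknown; the squeezes below exist to obtain Bf = 1 + χ. From then on f is the indicator of a
-- second code of the same size that also covers every word, and χ is its excess. This symmetry in χ
-- and f lets one uniqueness statement serve both parts of the theorem. The factor (1 - x)(1 - x²)^ν
-- comes from eigenfunctions. Once the constant solution is subtracted, the system reads Bu = v, Bv
-- = u, so u + v and u - v are eigenfunctions of B for 1 and -1. Around a word these distribute as
-- the Krawtchouk generating functions (1 - x²)^(ν + 1) and (1 - x)²(1 - x²)^ν, which are (1 + x)
-- and (1 - x) times that factor.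

module Counting where
  open import Data.Nat using (_+_; _*_; _≡ᵇ_)
  open import Data.Nat.Properties
  open import Data.Nat.Tactic.RingSolver using (solve-∀)
  open ≡-Reasoning

  -- Sums over the cube and over spheres.

  indicator : Bool → ℕ
  indicator b = if b then 1 else 0

  total : ∀ {n} → (Word n → ℕ) → ℕ
  total {zero}  g = g []
  total {suc n} g = total (g ∘ (false ∷_)) + total (g ∘ (true ∷_))

  -- Recursion on coordinates replaces filtering by `dist`: the first coordinate either agrees with
  -- that of the centre or uses up one of the disagreements. Identities about spheres then follow by
  -- induction on the length.
  sphere : ∀ {n} → ℕ → (Word n → ℕ) → Word n → ℕ
  sphere zero    g c       = g c
  sphere (suc i) g []      = 0
  sphere (suc i) g (b ∷ c) = sphere (suc i) (g ∘ (b ∷_)) c + sphere i (g ∘ (not b ∷_)) c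

  ball : ∀ {n} → (Word n → ℕ) → Word n → ℕ
  ball g c = g c + sphere 1 g c

  total-cong : ∀ {n} {g h : Word n → ℕ} → (∀ w → g w ≡ h w) → total g ≡ total h
  total-cong {zero}  e = e []
  total-cong {suc n} e = cong₂ _+_ (total-cong (e ∘ (false ∷_))) (total-cong (e ∘ (true ∷_)))

  interchange : ∀ a b c d → (a + b) + (c + d) ≡ (a + c) + (b + d)
  interchange = solve-∀

  total-+ : ∀ {n} (g h : Word n → ℕ) → total (λ w → g w + h w) ≡ total g + total h
  total-+ {zero}  g h = refl
  total-+ {suc n} g h = trans
    (cong₂ _+_ (total-+ (g ∘ (false ∷_)) (h ∘ (false ∷_))) (total-+ (g ∘ (true ∷_)) (h ∘ (true ∷_))))
    (interchange (total (g ∘ (false ∷_))) _ _ _)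

  total-* : ∀ {n} k (g : Word n → ℕ) → total (λ w → k * g w) ≡ k * total g
  total-* {zero}  k g = refl
  total-* {suc n} k g = trans
    (cong₂ _+_ (total-* k (g ∘ (false ∷_))) (total-* k (g ∘ (true ∷_))))
    (sym (*-distribˡ-+ k (total (g ∘ (false ∷_))) _))

  total-one : ∀ n → total {n} (λ _ → 1) ≡ 2 ^ n
  total-one zero    = refl
  total-one (suc n) = trans (cong₂ _+_ (total-one n) (total-one n)) (lemma (2 ^ n))
    where
    lemma : ∀ a → a + a ≡ 2 * a
    lemma = solve-∀

  total-mono : ∀ {n} {g h : Word n → ℕ} → (∀ w → g w ≤ h w) → total g ≤ total h
  total-mono {zero}  le = le []
  total-mono {suc n} le = +-mono-≤ (total-mono (le ∘ (false ∷_))) (total-mono (le ∘ (true ∷_)))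

  +-tightˡ : ∀ {a b c d} → a ≤ c → b ≤ d → c + d ≤ a + b → c ≤ a
  +-tightˡ {a} {b} {c} {d} a≤c b≤d le =
    +-cancelʳ-≤ b c a (≤-trans (+-monoʳ-≤ c b≤d) le)

  +-tightʳ : ∀ {a b c d} → a ≤ c → b ≤ d → c + d ≤ a + b → d ≤ b
  +-tightʳ {a} {b} {c} {d} a≤c b≤d le =
    +-cancelˡ-≤ a d b (≤-trans (+-monoˡ-≤ d a≤c) le)

  -- Turns a double count into pointwise identities; every squeeze in `NearlyPerfect` ends here.
  total-tight : ∀ {n} {g h : Word n → ℕ} → (∀ w → g w ≤ h w) → total h ≤ total g →
                ∀ w → g w ≡ h w
  total-tight {zero}  le tot []          = ≤-antisym (le []) tot
  total-tight {suc n} le tot (false ∷ w) = total-tight (le ∘ (false ∷_))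
    (+-tightˡ (total-mono (le ∘ (false ∷_))) (total-mono (le ∘ (true ∷_))) tot) w
  total-tight {suc n} le tot (true ∷ w)  = total-tight (le ∘ (true ∷_))
    (+-tightʳ (total-mono (le ∘ (false ∷_))) (total-mono (le ∘ (true ∷_))) tot) w

  sphere-cong : ∀ {n} i {g h : Word n → ℕ} → (∀ w → g w ≡ h w) → ∀ c → sphere i g c ≡ sphere i h c
  sphere-cong zero    e c       = e c
  sphere-cong (suc i) e []      = refl
  sphere-cong (suc i) e (b ∷ c) =
    cong₂ _+_ (sphere-cong (suc i) (e ∘ (b ∷_)) c) (sphere-cong i (e ∘ (not b ∷_)) c)

  sphere-+ : ∀ {n} i (g h : Word n → ℕ) c →
             sphere i (λ w → g w + h w) c ≡ sphere i g c + sphere i h c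
  sphere-+ zero    g h c       = refl
  sphere-+ (suc i) g h []      = refl
  sphere-+ (suc i) g h (b ∷ c) = trans
    (cong₂ _+_ (sphere-+ (suc i) (g ∘ (b ∷_)) (h ∘ (b ∷_)) c)
               (sphere-+ i (g ∘ (not b ∷_)) (h ∘ (not b ∷_)) c))
    (interchange (sphere (suc i) (g ∘ (b ∷_)) c) _ _ _)

  sphere-* : ∀ {n} i k (g : Word n → ℕ) c → sphere i (λ w → k * g w) c ≡ k * sphere i g c
  sphere-* zero    k g c       = refl
  sphere-* (suc i) k g []      = sym (*-zeroʳ k)
  sphere-* (suc i) k g (b ∷ c) = trans
    (cong₂ _+_ (sphere-* (suc i) k (g ∘ (b ∷_)) c) (sphere-* i k (g ∘ (not b ∷_)) c))
    (sym (*-distribˡ-+ k (sphere (suc i) (g ∘ (b ∷_)) c) _))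

  sphere-one : ∀ {n} i (c : Word n) → sphere i (λ _ → 1) c ≡ binom n i
  sphere-one {zero}  zero    []      = refl
  sphere-one {suc n} zero    (b ∷ c) = sphere-one zero c
  sphere-one         (suc i) []      = refl
  sphere-one {suc n} (suc i) (b ∷ c) = begin
    sphere (suc i) (λ _ → 1) c + sphere i (λ _ → 1) c
      ≡⟨ cong₂ _+_ (sphere-one (suc i) c) (sphere-one i c) ⟩
    binom n (suc i) + binom n i
      ≡⟨ +-comm (binom n (suc i)) _ ⟩
    binom n i + binom n (suc i)
      ≡⟨ nCk+nC[k+1]≡[n+1]C[k+1] n i ⟩
    binom (suc n) (suc i) ∎

  -- A vanishing sum of naturals has only vanishing terms, and factors from `h` keep them zero.
  sphere-*-zero : ∀ {n} i (g h : Word n → ℕ) c → sphere i g c ≡ 0 → sphere i (λ w → g w * h w) c ≡ 0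
  sphere-*-zero zero    g h c       e = cong (_* h c) e
  sphere-*-zero (suc i) g h []      e = refl
  sphere-*-zero (suc i) g h (b ∷ c) e = cong₂ _+_
    (sphere-*-zero (suc i) _ (h ∘ (b ∷_)) c (m+n≡0⇒m≡0 (sphere (suc i) (g ∘ (b ∷_)) c) e))
    (sphere-*-zero i _ (h ∘ (not b ∷_)) c (m+n≡0⇒n≡0 (sphere (suc i) (g ∘ (b ∷_)) c) e))

  -- The ball operator: recurrences by distance and self-adjointness.

  ball-∷ : ∀ {n} b (g : Word (suc n) → ℕ) w →
           ball g (b ∷ w) ≡ ball (g ∘ (b ∷_)) w + g (not b ∷ w)
  ball-∷ b g w = sym (+-assoc (g (b ∷ w)) _ _)

  ball-not∷ : ∀ {n} b (g : Word (suc n) → ℕ) w →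
              ball g (not b ∷ w) ≡ ball (g ∘ (not b ∷_)) w + g (b ∷ w)
  ball-not∷ false = ball-∷ true
  ball-not∷ true  = ball-∷ false

  -- A word at distance i from c has n − i neighbours at distance i + 1 from c, and one at distance
  -- i + 2 has i + 2 of them; i * sphere i g c stands on the left to avoid the subtraction.
  sphere-ball : ∀ {n} i (g : Word n → ℕ) c →
    sphere (suc i) (ball g) c + i * sphere i g c ≡
    sphere (suc i) g c + n * sphere i g c + (2 + i) * sphere (2 + i) g c
  sphere-ball zero    g [] = refl
  sphere-ball (suc i) g [] = trans (*-zeroʳ i) (sym (*-zeroʳ i))
  sphere-ball {suc n} zero g (b ∷ c) = begin
    sphere 1 (ball g ∘ (b ∷_)) c + ball g (not b ∷ c) + 0
      ≡⟨ cong (_+ 0) (cong₂ _+_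
           (trans (sphere-cong 1 (ball-∷ b g) c) (sphere-+ 1 (ball p) q c)) (ball-not∷ b g c)) ⟩
    sphere 1 (ball p) c + sphere 1 q c + (q c + sphere 1 q c + p c) + 0
      ≡⟨ l₁ (sphere 1 (ball p) c) (sphere 1 q c) (q c) (p c) ⟩
    (sphere 1 (ball p) c + 0) + (2 * sphere 1 q c + q c + p c)
      ≡⟨ cong (_+ (2 * sphere 1 q c + q c + p c)) (sphere-ball zero p c) ⟩
    sphere 1 p c + n * p c + 2 * sphere 2 p c + (2 * sphere 1 q c + q c + p c)
      ≡⟨ l₂ (sphere 1 p c) n (p c) (sphere 2 p c) (sphere 1 q c) (q c) ⟩
    sphere 1 p c + q c + suc n * p c + 2 * (sphere 2 p c + sphere 1 q c) ∎
    where
    p q : Word n → ℕ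
    p = g ∘ (b ∷_)
    q = g ∘ (not b ∷_)
    l₁ : ∀ x y z w → x + y + (z + y + w) + 0 ≡ (x + 0) + (2 * y + z + w)
    l₁ = solve-∀
    l₂ : ∀ x m y z u w → x + m * y + 2 * z + (2 * u + w + y) ≡ x + w + (1 + m) * y + 2 * (z + u)
    l₂ = solve-∀
  sphere-ball {suc n} (suc i) g (b ∷ c) = begin
    sphere (2 + i) (ball g ∘ (b ∷_)) c + sphere (1 + i) (ball g ∘ (not b ∷_)) c
      + suc i * (p₁ + q₀)
      ≡⟨ cong (_+ suc i * (p₁ + q₀)) (cong₂ _+_
           (trans (sphere-cong (2 + i) (ball-∷ b g) c) (sphere-+ (2 + i) (ball p) q c))
           (trans (sphere-cong (1 + i) (ball-not∷ b g) c) (sphere-+ (1 + i) (ball q) p c))) ⟩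
    sphere (2 + i) (ball p) c + q₂ + (sphere (1 + i) (ball q) c + p₁) + suc i * (p₁ + q₀)
      ≡⟨ l₁ (sphere (2 + i) (ball p) c) q₂ (sphere (1 + i) (ball q) c) p₁ i q₀ ⟩
    (sphere (2 + i) (ball p) c + suc i * p₁) + (sphere (1 + i) (ball q) c + i * q₀)
      + (q₂ + p₁ + q₀)
      ≡⟨ cong (_+ (q₂ + p₁ + q₀)) (cong₂ _+_ (sphere-ball (suc i) p c) (sphere-ball i q c)) ⟩
    (p₂ + n * p₁ + (3 + i) * p₃) + (q₁ + n * q₀ + (2 + i) * q₂) + (q₂ + p₁ + q₀)
      ≡⟨ l₂ p₂ n p₁ i p₃ q₁ q₀ q₂ ⟩
    p₂ + q₁ + suc n * (p₁ + q₀) + (3 + i) * (p₃ + q₂) ∎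
    where
    p q : Word n → ℕ
    p = g ∘ (b ∷_)
    q = g ∘ (not b ∷_)
    p₁ = sphere (1 + i) p c
    p₂ = sphere (2 + i) p c
    p₃ = sphere (3 + i) p c
    q₀ = sphere i q c
    q₁ = sphere (1 + i) q c
    q₂ = sphere (2 + i) q c
    l₁ : ∀ x y z w j v → x + y + (z + w) + (1 + j) * (w + v) ≡ (x + (1 + j) * w) + (z + j * v) + (y + w + v)
    l₁ = solve-∀
    l₂ : ∀ a m b j d e f h → (a + m * b + (3 + j) * d) + (e + m * f + (2 + j) * h) + (h + b + f)
         ≡ a + e + (1 + m) * (b + f) + (3 + j) * (d + h)
    l₂ = solve-∀

  -- Two moves of length at most 1 end at `c` in 1 + n ways (stay twice, or out and back), at a
  -- given neighbour in two ways (move first or second), and at a given word at distance 2 in two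
  -- orders. The factor 2 is the source of the parity argument.
  ball-ball : ∀ {n} (g : Word n → ℕ) c →
              ball (ball g) c ≡ (1 + n) * g c + 2 * (sphere 1 g c + sphere 2 g c)
  ball-ball {n} g c = begin
    g c + sphere 1 g c + sphere 1 (ball g) c
      ≡⟨ cong (g c + sphere 1 g c +_) (trans (sym (+-identityʳ _)) (sphere-ball zero g c)) ⟩
    g c + sphere 1 g c + (sphere 1 g c + n * g c + 2 * sphere 2 g c)
      ≡⟨ lemma (g c) (sphere 1 g c) n (sphere 2 g c) ⟩
    (1 + n) * g c + 2 * (sphere 1 g c + sphere 2 g c) ∎
    where
    lemma : ∀ a b m d → a + b + (b + m * a + 2 * d) ≡ (1 + m) * a + 2 * (b + d)
    lemma = solve-∀

  ball-cong : ∀ {n} {g h : Word n → ℕ} → (∀ w → g w ≡ h w) → ∀ c → ball g c ≡ ball h c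
  ball-cong e c = cong₂ _+_ (e c) (sphere-cong 1 e c)

  ball-+ : ∀ {n} (g h : Word n → ℕ) c → ball (λ w → g w + h w) c ≡ ball g c + ball h c
  ball-+ g h c = trans (cong (g c + h c +_) (sphere-+ 1 g h c)) (interchange (g c) _ _ _)

  sphere₁-one : ∀ {n} (c : Word n) → sphere 1 (λ _ → 1) c ≡ n
  sphere₁-one []      = refl
  sphere₁-one (b ∷ c) = trans (cong (_+ 1) (sphere₁-one c)) (+-comm _ 1)

  ball-one : ∀ {n} (c : Word n) → ball (λ _ → 1) c ≡ 1 + n
  ball-one c = cong suc (sphere₁-one c)

  -- This is `sphere-ball` for the constant function 1, whose ball sums all equal 1 + n.
  binom-recurrence : ∀ n i →
    (1 + n) * binom n (suc i) + i * binom n i ≡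
    binom n (suc i) + n * binom n i + (2 + i) * binom n (2 + i)
  binom-recurrence n i = begin
    (1 + n) * binom n (suc i) + i * binom n i
      ≡⟨ cong₂ (λ s t → (1 + n) * s + i * t) (sphere-one (suc i) c) (sphere-one i c) ⟨
    (1 + n) * sphere (suc i) (λ _ → 1) c + i * sphere i (λ _ → 1) c
      ≡⟨ cong (_+ i * sphere i (λ _ → 1) c) (sphere-* (suc i) (1 + n) (λ _ → 1) c) ⟨
    sphere (suc i) (λ _ → (1 + n) * 1) c + i * sphere i (λ _ → 1) c
      ≡⟨ cong (_+ i * sphere i (λ _ → 1) c)
           (sphere-cong (suc i) (λ w → trans (ball-one w) (sym (*-identityʳ (1 + n)))) c) ⟨
    sphere (suc i) (ball (λ _ → 1)) c + i * sphere i (λ _ → 1) c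
      ≡⟨ sphere-ball i (λ _ → 1) c ⟩
    sphere (suc i) (λ _ → 1) c + n * sphere i (λ _ → 1) c + (2 + i) * sphere (2 + i) (λ _ → 1) c
      ≡⟨ cong₂ _+_ (cong₂ (λ s t → s + n * t) (sphere-one (suc i) c) (sphere-one i c))
                   (cong ((2 + i) *_) (sphere-one (2 + i) c)) ⟩
    binom n (suc i) + n * binom n i + (2 + i) * binom n (2 + i) ∎
    where
    c = zeroWord {n}

  sphere-recurrence : ∀ {n} {g h : Word n → ℕ} → (∀ w → ball g w ≡ 1 + h w) → ∀ i c →
    binom n (suc i) + sphere (suc i) h c + i * sphere i g c ≡
    sphere (suc i) g c + n * sphere i g c + (2 + i) * sphere (2 + i) g c
  sphere-recurrence {n} {g} {h} e i c = begin
    binom n (suc i) + sphere (suc i) h c + i * sphere i g c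
      ≡⟨ cong (λ t → t + sphere (suc i) h c + i * sphere i g c) (sphere-one (suc i) c) ⟨
    sphere (suc i) (λ _ → 1) c + sphere (suc i) h c + i * sphere i g c
      ≡⟨ cong (_+ i * sphere i g c) (sphere-+ (suc i) (λ _ → 1) h c) ⟨
    sphere (suc i) (λ w → 1 + h w) c + i * sphere i g c
      ≡⟨ cong (_+ i * sphere i g c) (sphere-cong (suc i) e c) ⟨
    sphere (suc i) (ball g) c + i * sphere i g c
      ≡⟨ sphere-ball i g c ⟩
    sphere (suc i) g c + n * sphere i g c + (2 + i) * sphere (2 + i) g c ∎

  -- Being at distance at most 1 is a symmetric relation, so the ball operator is self-adjoint. In
  -- the induction the two cross terms between the halves of the cube trade places.
  total-ball-sym : ∀ {n} (g h : Word n → ℕ) →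
                   total (λ w → g w * ball h w) ≡ total (λ w → h w * ball g w)
  total-ball-sym {zero}  g h = lemma (g []) (h [])
    where
    lemma : ∀ a b → a * (b + 0) ≡ b * (a + 0)
    lemma = solve-∀
  total-ball-sym {suc n} g h = begin
    total (λ w → g₀ w * ball h (false ∷ w)) + total (λ w → g₁ w * ball h (true ∷ w))
      ≡⟨ cong₂ _+_ (expand false g h) (expand true g h) ⟩
    (total (λ w → g₀ w * ball h₀ w) + total (λ w → g₀ w * h₁ w))
      + (total (λ w → g₁ w * ball h₁ w) + total (λ w → g₁ w * h₀ w))
      ≡⟨ cong₂ _+_ (cong₂ _+_ (total-ball-sym g₀ h₀) (total-cong (λ w → *-comm (g₀ w) _)))
                   (cong₂ _+_ (total-ball-sym g₁ h₁) (total-cong (λ w → *-comm (g₁ w) _))) ⟩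
    (total (λ w → h₀ w * ball g₀ w) + total (λ w → h₁ w * g₀ w))
      + (total (λ w → h₁ w * ball g₁ w) + total (λ w → h₀ w * g₁ w))
      ≡⟨ swap (total (λ w → h₀ w * ball g₀ w)) _ _ _ ⟩
    (total (λ w → h₀ w * ball g₀ w) + total (λ w → h₀ w * g₁ w))
      + (total (λ w → h₁ w * ball g₁ w) + total (λ w → h₁ w * g₀ w))
      ≡⟨ cong₂ _+_ (expand false h g) (expand true h g) ⟨
    total (λ w → h₀ w * ball g (false ∷ w)) + total (λ w → h₁ w * ball g (true ∷ w)) ∎
    where
    g₀ = g ∘ (false ∷_)
    g₁ = g ∘ (true ∷_)
    h₀ = h ∘ (false ∷_)
    h₁ = h ∘ (true ∷_)
    expand : ∀ b (u v : Word (suc n) → ℕ) →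
      total (λ w → u (b ∷ w) * ball v (b ∷ w)) ≡
      total (λ w → u (b ∷ w) * ball (v ∘ (b ∷_)) w) + total (λ w → u (b ∷ w) * v (not b ∷ w))
    expand b u v = trans
      (total-cong (λ w → trans (cong (u (b ∷ w) *_) (ball-∷ b v w)) (*-distribˡ-+ (u (b ∷ w)) _ _)))
      (total-+ (λ w → u (b ∷ w) * ball (v ∘ (b ∷_)) w) _)
    swap : ∀ a b c d → (a + b) + (c + d) ≡ (a + d) + (c + b)
    swap = solve-∀

  total-ball : ∀ {n} (g : Word n → ℕ) → total (ball g) ≡ (1 + n) * total g
  total-ball {n} g = begin
    total (ball g)
      ≡⟨ total-cong (λ w → sym (*-identityˡ (ball g w))) ⟩
    total (λ w → 1 * ball g w)
      ≡⟨ total-ball-sym (λ _ → 1) g ⟩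
    total (λ w → g w * ball (λ _ → 1) w)
      ≡⟨ total-cong (λ w → trans (cong (g w *_) (ball-one w)) (*-comm (g w) _)) ⟩
    total (λ w → (1 + n) * g w)
      ≡⟨ total-* (1 + n) g ⟩
    (1 + n) * total g ∎

  -- From individual words to sphere sums.

  sphere-lower : ∀ {n} (g : Word n → ℕ) c w → g w ≤ sphere (dist c w) g c
  sphere-lower g []          []          = ≤-refl
  sphere-lower g (false ∷ c) (false ∷ w) with dist c w | sphere-lower (g ∘ (false ∷_)) c w
  ... | zero  | le = le
  ... | suc i | le = ≤-trans le (m≤m+n _ _)
  sphere-lower g (true ∷ c)  (true ∷ w)  with dist c w | sphere-lower (g ∘ (true ∷_)) c w
  ... | zero  | le = le
  ... | suc i | le = ≤-trans le (m≤m+n _ _)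
  sphere-lower g (false ∷ c) (true ∷ w)  = ≤-trans (sphere-lower (g ∘ (true ∷_)) c w) (m≤n+m _ _)
  sphere-lower g (true ∷ c)  (false ∷ w) = ≤-trans (sphere-lower (g ∘ (false ∷_)) c w) (m≤n+m _ _)

  sphere-lower′ : ∀ {n i} (g : Word n → ℕ) c w → dist c w ≡ i → g w ≤ sphere i g c
  sphere-lower′ g c w refl = sphere-lower g c w

  dist-self : ∀ {n} (c : Word n) → dist c c ≡ 0
  dist-self []          = refl
  dist-self (false ∷ c) = dist-self c
  dist-self (true ∷ c)  = dist-self c

  dist≡0 : ∀ {n} (c w : Word n) → dist c w ≡ 0 → c ≡ w
  dist≡0 []          []          e = refl
  dist≡0 (false ∷ c) (false ∷ w) e = cong (false ∷_) (dist≡0 c w e)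
  dist≡0 (true ∷ c)  (true ∷ w)  e = cong (true ∷_) (dist≡0 c w e)

  dist-zeroWord : ∀ {n} (w : Word n) → dist zeroWord w ≡ weight w
  dist-zeroWord []          = refl
  dist-zeroWord (false ∷ w) = dist-zeroWord w
  dist-zeroWord (true ∷ w)  = cong suc (dist-zeroWord w)

  -- While `u` and `v` agree in the first coordinate the induction follows both; where they first
  -- differ they fall into different summands of `sphere`, each bounded by `sphere-lower′`.
  sphere-lower₂ : ∀ {n i} (g : Word n → ℕ) c u v → u ≢ v → dist c u ≡ i → dist c v ≡ i →
                  g u + g v ≤ sphere i g c
  sphere-lower₂ {i = zero} g c u v u≢v eu ev =
    contradiction (trans (sym (dist≡0 c u eu)) (dist≡0 c v ev)) u≢v
  sphere-lower₂ {i = suc i} g [] [] [] u≢v () ev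
  sphere-lower₂ {i = suc i} g (false ∷ c) (false ∷ u) (false ∷ v) u≢v eu ev =
    ≤-trans (sphere-lower₂ (g ∘ (false ∷_)) c u v (u≢v ∘ cong (false ∷_)) eu ev) (m≤m+n _ _)
  sphere-lower₂ {i = suc i} g (true ∷ c) (true ∷ u) (true ∷ v) u≢v eu ev =
    ≤-trans (sphere-lower₂ (g ∘ (true ∷_)) c u v (u≢v ∘ cong (true ∷_)) eu ev) (m≤m+n _ _)
  sphere-lower₂ {i = suc i} g (false ∷ c) (true ∷ u) (true ∷ v) u≢v eu ev =
    ≤-trans (sphere-lower₂ (g ∘ (true ∷_)) c u v (u≢v ∘ cong (true ∷_)) (suc-injective eu) (suc-injective ev)) (m≤n+m _ _)
  sphere-lower₂ {i = suc i} g (true ∷ c) (false ∷ u) (false ∷ v) u≢v eu ev =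
    ≤-trans (sphere-lower₂ (g ∘ (false ∷_)) c u v (u≢v ∘ cong (false ∷_)) (suc-injective eu) (suc-injective ev)) (m≤n+m _ _)
  sphere-lower₂ {i = suc i} g (false ∷ c) (false ∷ u) (true ∷ v) u≢v eu ev =
    +-mono-≤ (sphere-lower′ (g ∘ (false ∷_)) c u eu) (sphere-lower′ (g ∘ (true ∷_)) c v (suc-injective ev))
  sphere-lower₂ {i = suc i} g (true ∷ c) (true ∷ u) (false ∷ v) u≢v eu ev =
    +-mono-≤ (sphere-lower′ (g ∘ (true ∷_)) c u eu) (sphere-lower′ (g ∘ (false ∷_)) c v (suc-injective ev))
  sphere-lower₂ {i = suc i} g (false ∷ c) (true ∷ u) (false ∷ v) u≢v eu ev = ≤-trans
    (≤-reflexive (+-comm (g (true ∷ u)) _))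
    (+-mono-≤ (sphere-lower′ (g ∘ (false ∷_)) c v ev) (sphere-lower′ (g ∘ (true ∷_)) c u (suc-injective eu)))
  sphere-lower₂ {i = suc i} g (true ∷ c) (false ∷ u) (true ∷ v) u≢v eu ev = ≤-trans
    (≤-reflexive (+-comm (g (false ∷ u)) _))
    (+-mono-≤ (sphere-lower′ (g ∘ (true ∷_)) c v ev) (sphere-lower′ (g ∘ (false ∷_)) c u (suc-injective eu)))

  sphere-zero : ∀ {n} i (g : Word n → ℕ) c → (∀ w → dist c w ≡ i → g w ≡ 0) → sphere i g c ≡ 0
  sphere-zero zero g c z = z c (dist-self c)
  sphere-zero (suc i) g []          z = refl
  sphere-zero (suc i) g (false ∷ c) z = cong₂ _+_
    (sphere-zero (suc i) _ c (λ w → z (false ∷ w))) (sphere-zero i _ c (λ w → z (true ∷ w) ∘ cong suc))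
  sphere-zero (suc i) g (true ∷ c)  z = cong₂ _+_
    (sphere-zero (suc i) _ c (λ w → z (true ∷ w))) (sphere-zero i _ c (λ w → z (false ∷ w) ∘ cong suc))

  sphere-shift : ∀ {n} i (g : Word n → ℕ) c x → sphere i (λ w → g (w ⊕ x)) c ≡ sphere i g (c ⊕ x)
  sphere-shift zero    g c           x           = refl
  sphere-shift (suc i) g []          []          = refl
  sphere-shift (suc i) g (false ∷ c) (false ∷ x) =
    cong₂ _+_ (sphere-shift (suc i) (g ∘ (false ∷_)) c x) (sphere-shift i (g ∘ (true ∷_)) c x)
  sphere-shift (suc i) g (false ∷ c) (true ∷ x)  =
    cong₂ _+_ (sphere-shift (suc i) (g ∘ (true ∷_)) c x) (sphere-shift i (g ∘ (false ∷_)) c x)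
  sphere-shift (suc i) g (true ∷ c)  (false ∷ x) =
    cong₂ _+_ (sphere-shift (suc i) (g ∘ (true ∷_)) c x) (sphere-shift i (g ∘ (false ∷_)) c x)
  sphere-shift (suc i) g (true ∷ c)  (true ∷ x)  =
    cong₂ _+_ (sphere-shift (suc i) (g ∘ (false ∷_)) c x) (sphere-shift i (g ∘ (true ∷_)) c x)

  -- Weight counts as sphere sums around the zero word.

  sum-allWords : ∀ {n} (g : Word n → ℕ) → sum (map g (allWords n)) ≡ total g
  sum-allWords {zero}  g = +-identityʳ (g [])
  sum-allWords {suc n} g = begin
    sum (map g (map (false ∷_) (allWords n) ++ map (true ∷_) (allWords n)))
      ≡⟨ cong sum (map-++ g (map (false ∷_) (allWords n)) _) ⟩
    sum (map g (map (false ∷_) (allWords n)) ++ map g (map (true ∷_) (allWords n)))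
      ≡⟨ sum-++ (map g (map (false ∷_) (allWords n))) _ ⟩
    sum (map g (map (false ∷_) (allWords n))) + sum (map g (map (true ∷_) (allWords n)))
      ≡⟨ cong₂ _+_ (half false) (half true) ⟩
    total g ∎
    where
    half : ∀ b → sum (map g (map (b ∷_) (allWords n))) ≡ total (g ∘ (b ∷_))
    half b = trans (cong sum (sym (map-∘ (allWords n)))) (sum-allWords (g ∘ (b ∷_)))

  size-total : ∀ {n} (C : Code n) → size C ≡ total (indicator ∘ C)
  size-total C = sum-allWords (indicator ∘ C)

  total-zero : ∀ n → total {n} (λ _ → 0) ≡ 0
  total-zero zero    = refl
  total-zero (suc n) = cong₂ _+_ (total-zero n) (total-zero n)

  total-weight : ∀ {n} i (C : Code n) →
    total (λ w → indicator (C w ∧ (weight w ≡ᵇ i))) ≡ sphere i (indicator ∘ C) zeroWord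
  total-weight {zero}  zero    C = cong indicator (∧-identityʳ (C []))
  total-weight {zero}  (suc i) C = cong indicator (∧-zeroʳ (C []))
  total-weight {suc n} zero    C = trans
    (cong₂ _+_ (total-weight zero (C ∘ (false ∷_)))
      (trans (total-cong (λ w → cong indicator (∧-zeroʳ (C (true ∷ w))))) (total-zero n)))
    (+-identityʳ _)
  total-weight {suc n} (suc i) C =
    cong₂ _+_ (total-weight (suc i) (C ∘ (false ∷_))) (total-weight i (C ∘ (true ∷_)))

  A-sphere : ∀ {n} i (C : Code n) → A i C ≡ sphere i (indicator ∘ C) zeroWord
  A-sphere i C = trans (sum-allWords (λ w → indicator (C w ∧ (weight w ≡ᵇ i)))) (total-weight i C)

-- The excess of a nearly perfect code.

module NearlyPerfect
  {n ν : ℕ} (C : Code n) (n≡2+2ν : n ≡ 2 ℕ.+ 2 ℕ.* ν) (3∤n² : ¬ 3 ∣ n ℕ.* n)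
  (size≡ : n ℕ.* Counting.total (Counting.indicator ∘ C) ≡ 2 ^ n)
  (cover : ∀ x → 1 ≤ Counting.ball (Counting.indicator ∘ C) x)
  where
  open import Data.Nat using (_+_; _*_)
  open import Data.Nat.Properties
  open import Data.Nat.Tactic.RingSolver using (solve-∀)
  open Counting
  open ≡-Reasoning

  -- This is n - 1, the ratio of the number of non-codewords to the number of codewords.
  m : ℕ
  m = 1 + 2 * ν

  χ χ̄ excess : Word n → ℕ
  χ w      = indicator (C w)
  χ̄ w      = indicator (not (C w))
  excess w = ball χ w ∸ 1

  χ+χ̄ : ∀ w → χ w + χ̄ w ≡ 1
  χ+χ̄ w with C w
  ... | true  = refl
  ... | false = refl

  χ-cases : ∀ w → (χ w ≡ 1 × χ̄ w ≡ 0) ⊎ (χ w ≡ 0 × χ̄ w ≡ 1)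
  χ-cases w with C w
  ... | true  = inj₁ (refl , refl)
  ... | false = inj₂ (refl , refl)

  ball-χ : ∀ w → ball χ w ≡ 1 + excess w
  ball-χ w = sym (m+[n∸m]≡n (cover w))

  -- A ball has n + 1 = m + 2 words, and 1 + `excess w` of them are codewords.
  excess+ball-χ̄ : ∀ w → excess w + ball χ̄ w ≡ 1 + m
  excess+ball-χ̄ w = suc-injective $ begin
    1 + excess w + ball χ̄ w       ≡⟨ cong (_+ ball χ̄ w) (ball-χ w) ⟨
    ball χ w + ball χ̄ w           ≡⟨ ball-+ χ χ̄ w ⟨
    ball (λ w → χ w + χ̄ w) w      ≡⟨ ball-cong χ+χ̄ w ⟩
    ball (λ _ → 1) w              ≡⟨ ball-one w ⟩
    1 + n                         ≡⟨ cong suc n≡2+2ν ⟩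
    2 + m                         ∎

  total-χ̄ : total χ̄ ≡ m * total χ
  total-χ̄ = +-cancelˡ-≡ (total χ) _ _ $ begin
    total χ + total χ̄            ≡⟨ total-+ χ χ̄ ⟨
    total (λ w → χ w + χ̄ w)      ≡⟨ total-cong χ+χ̄ ⟩
    total {n} (λ _ → 1)          ≡⟨ total-one n ⟩
    2 ^ n                        ≡⟨ size≡ ⟨
    n * total χ                  ≡⟨ cong (_* total χ) n≡2+2ν ⟩
    total χ + m * total χ        ∎

  total-excess : total excess ≡ total χ
  total-excess = +-cancelˡ-≡ (2 ^ n) _ _ $ begin
    2 ^ n + total excess               ≡⟨ cong (_+ total excess) (total-one n) ⟨
    total {n} (λ _ → 1) + total excess ≡⟨ total-+ (λ _ → 1) excess ⟨
    total (λ w → 1 + excess w)         ≡⟨ total-cong ball-χ ⟨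
    total (ball χ)                     ≡⟨ total-ball χ ⟩
    total χ + n * total χ              ≡⟨ cong (total χ +_) size≡ ⟩
    total χ + 2 ^ n                    ≡⟨ +-comm (total χ) _ ⟩
    2 ^ n + total χ                    ∎

  near : Word n → ℕ
  near c = sphere 1 χ c + sphere 2 χ c

  -- Both sides are the ball operator applied twice to `χ`, once through `ball-χ` and once through
  -- `ball-ball`. As 1 + n is odd, the parity of `ball excess` is visible on and off the code.
  ball-excess : ∀ c → 1 + n + ball excess c ≡ (1 + n) * χ c + 2 * near c
  ball-excess c = begin
    1 + n + ball excess c                 ≡⟨ cong (_+ ball excess c) (ball-one c) ⟨
    ball (λ _ → 1) c + ball excess c      ≡⟨ ball-+ (λ _ → 1) excess c ⟨
    ball (λ w → 1 + excess w) c           ≡⟨ ball-cong ball-χ c ⟨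
    ball (ball χ) c                       ≡⟨ ball-ball χ c ⟩
    (1 + n) * χ c + 2 * near c            ∎

  odd≢even : ∀ a b → 1 + 2 * a ≢ 2 * b
  odd≢even a b e = from-no (2 ∣? 1) $
    ∣m+n∣m⇒∣n
      (divides b (trans (trans (+-comm (2 * a) 1) e) (*-comm 2 b))) (m∣m*n a)

  ball-excess-off : ∀ c → χ c ≡ 0 → 1 ≤ ball excess c
  ball-excess-off c off = n≢0⇒n>0 λ z → odd≢even (1 + ν) (near c) $ begin
    1 + 2 * (1 + ν)             ≡⟨ cong suc (*-distribˡ-+ 2 1 ν) ⟩
    1 + (2 + 2 * ν)             ≡⟨ cong suc n≡2+2ν ⟨
    1 + n                       ≡⟨ +-identityʳ (1 + n) ⟨
    1 + n + 0                   ≡⟨ cong (1 + n +_) z ⟨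
    1 + n + ball excess c       ≡⟨ ball-excess c ⟩
    (1 + n) * χ c + 2 * near c  ≡⟨ cong (λ t → (1 + n) * t + 2 * near c) off ⟩
    (1 + n) * 0 + 2 * near c    ≡⟨ cong (_+ 2 * near c) (*-zeroʳ (1 + n)) ⟩
    2 * near c                  ∎

  ball-excess-on : ∀ c → χ c ≡ 1 → ball excess c ≡ 2 * near c
  ball-excess-on c on = +-cancelˡ-≡ (1 + n) _ _ $ begin
    1 + n + ball excess c       ≡⟨ ball-excess c ⟩
    (1 + n) * χ c + 2 * near c  ≡⟨ cong (λ t → (1 + n) * t + 2 * near c) on ⟩
    (1 + n) * 1 + 2 * near c    ≡⟨ cong (_+ 2 * near c) (*-identityʳ (1 + n)) ⟩
    1 + n + 2 * near c          ∎

  χ̄≤χ̄*ball-excess : ∀ w → χ̄ w ≤ χ̄ w * ball excess w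
  χ̄≤χ̄*ball-excess w with χ-cases w
  ... | inj₁ (_ , e)   rewrite e = z≤n
  ... | inj₂ (off , e) rewrite e = ≤-trans (ball-excess-off w off) (≤-reflexive (sym (+-identityʳ _)))

  -- With f for the excess this says f (n - f) ≤ (n - 1) f, where equality holds only for f = 0 and
  -- f = 1. That equality case is how `excess≤1` arises.
  excess*ball-χ̄≤ : ∀ w → excess w * ball χ̄ w ≤ m * excess w
  excess*ball-χ̄≤ w with excess w | excess+ball-χ̄ w
  ... | zero  | _ = z≤n
  ... | suc k | e = ≤-trans (*-monoʳ-≤ (suc k) (≤-trans (m≤n+m _ k) (≤-reflexive (suc-injective e))))
                            (≤-reflexive (*-comm (suc k) m))

  total-χ̄*ball-excess : total (λ w → χ̄ w * ball excess w) ≡ total (λ w → excess w * ball χ̄ w)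
  total-χ̄*ball-excess = total-ball-sym χ̄ excess

  total-m*excess : total (λ w → m * excess w) ≡ total χ̄
  total-m*excess = begin
    total (λ w → m * excess w) ≡⟨ total-* m excess ⟩
    m * total excess           ≡⟨ cong (m *_) total-excess ⟩
    m * total χ                ≡⟨ total-χ̄ ⟨
    total χ̄                    ∎

  -- Double counting Σ χ̄ · ball excess = Σ excess · ball χ̄ squeezes both pointwise bounds.
  χ̄*ball-excess : ∀ w → χ̄ w ≡ χ̄ w * ball excess w
  χ̄*ball-excess = total-tight χ̄≤χ̄*ball-excess $ ≤-trans (≤-reflexive total-χ̄*ball-excess) $
    ≤-trans (total-mono excess*ball-χ̄≤) (≤-reflexive total-m*excess)

  excess*ball-χ̄ : ∀ w → excess w * ball χ̄ w ≡ m * excess w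
  excess*ball-χ̄ = total-tight excess*ball-χ̄≤ $ ≤-trans (≤-reflexive total-m*excess) $
    ≤-trans (total-mono χ̄≤χ̄*ball-excess) (≤-reflexive total-χ̄*ball-excess)

  excess≤1 : ∀ w → excess w ≡ 0 ⊎ excess w ≡ 1
  excess≤1 w with excess w | excess+ball-χ̄ w | excess*ball-χ̄ w
  ... | zero  | _  | _   = inj₁ refl
  ... | suc k | e₊ | e* = inj₂ (cong suc (+-cancelʳ-≡ m k 0 (trans (cong (k +_) (sym b≡m)) (suc-injective e₊))))
    where
    b≡m : ball χ̄ w ≡ m
    b≡m = *-cancelˡ-≡ (ball χ̄ w) m (suc k) (trans e* (*-comm m (suc k)))

  ball-excess-split : ∀ w → ball excess w ≡ χ w * ball excess w + χ̄ w
  ball-excess-split w = begin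
    ball excess w                                 ≡⟨ +-identityʳ (ball excess w) ⟨
    1 * ball excess w                             ≡⟨ cong (_* ball excess w) (χ+χ̄ w) ⟨
    (χ w + χ̄ w) * ball excess w                   ≡⟨ *-distribʳ-+ (ball excess w) (χ w) _ ⟩
    χ w * ball excess w + χ̄ w * ball excess w     ≡⟨ cong (χ w * ball excess w +_) (χ̄*ball-excess w) ⟨
    χ w * ball excess w + χ̄ w                     ∎

  -- Around a codeword c with no codeword at distance 1 or 2, the words at distance 1 force
  -- n/2 excess words at distance 2, hence 3 A₃ = C(n,2) + n/2 = n²/2 codewords at distance 3.
  module Isolated (c : Word n) (on : χ c ≡ 1) (bare : ball excess c ≡ 0) where
    a φ : ℕ → ℕ
    a i = sphere i χ c
    φ i = sphere i excess c

    φ₀ : φ 0 ≡ 0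
    φ₀ = m+n≡0⇒m≡0 (φ 0) bare

    φ₁ : φ 1 ≡ 0
    φ₁ = m+n≡0⇒n≡0 (φ 0) bare

    near≡0 : near c ≡ 0
    near≡0 = m+n≡0⇒m≡0 (near c) (trans (sym (ball-excess-on c on)) bare)

    a₁ : a 1 ≡ 0
    a₁ = m+n≡0⇒m≡0 (a 1) near≡0

    a₂ : a 2 ≡ 0
    a₂ = m+n≡0⇒n≡0 (a 1) near≡0

    2b₂ : n + 2 * binom n 2 ≡ n * n
    2b₂ = +-cancelˡ-≡ n _ _ $ begin
      n + (n + 2 * binom n 2)
        ≡⟨ lemma n (binom n 2) ⟩
      n + n * 1 + 2 * binom n 2
        ≡⟨ cong (λ t → t + n * 1 + 2 * binom n 2) (nC1≡n n) ⟨
      binom n 1 + n * 1 + 2 * binom n 2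
        ≡⟨ binom-recurrence n 0 ⟨
      (1 + n) * binom n 1 + 0
        ≡⟨ +-identityʳ _ ⟩
      (1 + n) * binom n 1
        ≡⟨ cong ((1 + n) *_) (nC1≡n n) ⟩
      n + n * n ∎
      where
      lemma : ∀ x y → x + (x + 2 * y) ≡ x + x * 1 + 2 * y
      lemma = solve-∀

    -- All n neighbours of `c` are off the code and so have ball excess exactly 1. Summed over them,
    -- an excess word at distance 2 is counted twice, and none lies closer.
    2φ₂ : 2 * φ 2 ≡ n
    2φ₂ = begin
      2 * φ 2                               ≡⟨ cong (_+ 2 * φ 2) (trans (cong₂ (λ s t → s + n * t) φ₁ φ₀) (*-zeroʳ n)) ⟨
      φ 1 + n * φ 0 + 2 * φ 2               ≡⟨ sphere-ball 0 excess c ⟨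
      sphere 1 (ball excess) c + 0          ≡⟨ +-identityʳ _ ⟩
      sphere 1 (ball excess) c              ≡⟨ sphere-cong 1 ball-excess-split c ⟩
      sphere 1 (λ w → χ w * ball excess w + χ̄ w) c
        ≡⟨ sphere-+ 1 (λ w → χ w * ball excess w) χ̄ c ⟩
      sphere 1 (λ w → χ w * ball excess w) c + sphere 1 χ̄ c
        -- The vanishing term is written as `a 1`, also zero, so that `χ` and `χ̄` recombine to the
        -- constant 1.
        ≡⟨ cong (_+ sphere 1 χ̄ c) (trans (sphere-*-zero 1 χ (ball excess) c a₁) (sym a₁)) ⟩
      a 1 + sphere 1 χ̄ c                    ≡⟨ sphere-+ 1 χ χ̄ c ⟨
      sphere 1 (λ w → χ w + χ̄ w) c          ≡⟨ sphere-cong 1 χ+χ̄ c ⟩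
      sphere 1 (λ _ → 1) c                  ≡⟨ sphere₁-one c ⟩
      n                                     ∎

    -- The words at distance 2 can be covered only by codewords at distance 3, each of which has
    -- three neighbours among them.
    3a₃ : 3 * a 3 ≡ binom n 2 + φ 2
    3a₃ = begin
      3 * a 3                         ≡⟨ cong (_+ 3 * a 3) (trans (cong₂ (λ s t → s + n * t) a₂ a₁) (*-zeroʳ n)) ⟨
      a 2 + n * a 1 + 3 * a 3         ≡⟨ sphere-recurrence ball-χ 1 c ⟨
      binom n 2 + φ 2 + 1 * a 1       ≡⟨ cong (λ t → binom n 2 + φ 2 + 1 * t) a₁ ⟩
      binom n 2 + φ 2 + 0             ≡⟨ +-identityʳ _ ⟩
      binom n 2 + φ 2                 ∎

    3∣n² : 3 ∣ n * n
    3∣n² = divides (2 * a 3) $ begin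
      n * n                 ≡⟨ 2b₂ ⟨
      n + 2 * binom n 2           ≡⟨ cong (_+ 2 * binom n 2) 2φ₂ ⟨
      2 * φ 2 + 2 * binom n 2     ≡⟨ lemma (φ 2) (binom n 2) ⟩
      2 * (binom n 2 + φ 2)       ≡⟨ cong (2 *_) 3a₃ ⟨
      2 * (3 * a 3)         ≡⟨ lemma′ (a 3) ⟩
      2 * a 3 * 3           ∎
      where
      lemma : ∀ x y → 2 * x + 2 * y ≡ 2 * (y + x)
      lemma = solve-∀
      lemma′ : ∀ x → 2 * (3 * x) ≡ 2 * x * 3
      lemma′ = solve-∀

  near-on : ∀ c → χ c ≡ 1 → 1 ≤ near c
  near-on c on = n≢0⇒n>0 λ z →
    3∤n² (Isolated.3∣n² c on (trans (ball-excess-on c on) (cong (2 *_) z)))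

  2χ≤χ*ball-excess : ∀ w → 2 * χ w ≤ χ w * ball excess w
  2χ≤χ*ball-excess w with χ-cases w
  ... | inj₂ (e , _)  rewrite e = z≤n
  ... | inj₁ (on , _) = ≤-trans (≤-reflexive (cong (2 *_) on)) $
    ≤-trans (*-monoʳ-≤ 2 (near-on w on)) $ ≤-reflexive $ begin
      2 * near w            ≡⟨ ball-excess-on w on ⟨
      ball excess w         ≡⟨ +-identityʳ _ ⟨
      1 * ball excess w     ≡⟨ cong (_* ball excess w) on ⟨
      χ w * ball excess w   ∎

  -- Moving the ball operator from f to χ turns the total into Σ f (1 + f), which is 2 Σ f because f
  -- is 0 or 1. So `ball excess` averages 2 over the code, while `near-on` makes it at least 2 at
  -- each codeword.
  χ*ball-excess : ∀ w → 2 * χ w ≡ χ w * ball excess w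
  χ*ball-excess = total-tight 2χ≤χ*ball-excess $ ≤-reflexive $ begin
    total (λ w → χ w * ball excess w)   ≡⟨ total-ball-sym χ excess ⟩
    total (λ w → excess w * ball χ w)   ≡⟨ total-cong idempotent ⟩
    total (λ w → 2 * excess w)          ≡⟨ total-* 2 excess ⟩
    2 * total excess                    ≡⟨ cong (2 *_) total-excess ⟩
    2 * total χ                         ≡⟨ total-* 2 χ ⟨
    total (λ w → 2 * χ w)               ∎
    where
    idempotent : ∀ w → excess w * ball χ w ≡ 2 * excess w
    idempotent w rewrite ball-χ w with excess≤1 w
    ... | inj₁ e rewrite e = refl
    ... | inj₂ e rewrite e = refl

  ball-excess≡ : ∀ w → ball excess w ≡ 1 + χ w
  ball-excess≡ w = begin
    ball excess w                                 ≡⟨ ball-excess-split w ⟩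
    χ w * ball excess w + χ̄ w                     ≡⟨ cong (_+ χ̄ w) (χ*ball-excess w) ⟨
    2 * χ w + χ̄ w                                 ≡⟨ lemma (χ w) (χ̄ w) ⟩
    (χ w + χ̄ w) + χ w                             ≡⟨ cong (_+ χ w) (χ+χ̄ w) ⟩
    1 + χ w                                       ∎
    where
    lemma : ∀ x y → 2 * x + y ≡ (x + y) + x
    lemma = solve-∀

  -- Existence and uniqueness of the partner; it later shows that a codeword of weight two leaves no
  -- room for one of weight one.
  near≡1 : ∀ c → χ c ≡ 1 → near c ≡ 1
  near≡1 c on = *-cancelˡ-≡ (near c) 1 2 $
    trans (sym (ball-excess-on c on)) (trans (ball-excess≡ c) (cong suc on))

open import Data.Integer using (ℤ; +_; _+_; _-_; _*_; -_; 0ℤ; 1ℤ; -1ℤ)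

-- The numbers Δ and their recurrence.

module Signs where
  open ≡-Reasoning

  private module ℤ-Group = Algebra.Properties.Group (AbelianGroup.group ℤₚ.+-0-abelianGroup)

  -- The case split of `Δ` on `i % 4` does not suit induction; the same sign pattern does, as a flip
  -- every two steps.
  sgn : ℕ → ℤ
  sgn zero          = 1ℤ
  sgn (suc zero)    = -1ℤ
  sgn (suc (suc i)) = - sgn i

  sgn-%4 : ∀ i → sgn i ≡ sgn (i % 4)
  sgn-%4 0 = refl
  sgn-%4 1 = refl
  sgn-%4 2 = refl
  sgn-%4 3 = refl
  sgn-%4 (suc (suc (suc (suc i)))) = trans (ℤₚ.neg-involutive (sgn i)) (sgn-%4 i)

  Δ-sgn : ∀ ν i → Δ ν i ≡ sgn i * + binom ν (i / 2)
  Δ-sgn ν i rewrite sgn-%4 i with i % 4 | m%n<n i 4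
  ... | 0 | _ = sym (ℤₚ.*-identityˡ _)
  ... | 1 | _ = sym (ℤₚ.-1*i≡-i _)
  ... | 2 | _ = sym (ℤₚ.-1*i≡-i _)
  ... | 3 | _ = sym (ℤₚ.*-identityˡ _)
  ... | suc (suc (suc (suc _))) | ℕ.s≤s (ℕ.s≤s (ℕ.s≤s (ℕ.s≤s ())))

  half-step : ∀ i → suc (suc i) / 2 ≡ suc (i / 2)
  half-step i = m/n≡1+[m∸n]/n {suc (suc i)} {2} (s≤s (s≤s z≤n))

  -- From one index to the next exactly one of the two factors of `Δ`, sign or halved index,
  -- changes; these are the two cases of `δ-recurrence`.
  data ParityStep (i : ℕ) : Set where
    even : i ≡ 2 ℕ.* (i / 2) → sgn (suc i) ≡ - sgn i → suc i / 2 ≡ i / 2 → ParityStep i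
    odd  : i ≡ suc (2 ℕ.* (i / 2)) → sgn (suc i) ≡ sgn i → suc i / 2 ≡ suc (i / 2) → ParityStep i

  parityStep : ∀ i → ParityStep i
  parityStep 0 = even refl refl refl
  parityStep 1 = odd refl refl refl
  parityStep (suc (suc i)) with parityStep i
  ... | even e s h = even
    (trans (cong (λ t → 2 ℕ.+ t) e) (trans (sym (ℕₚ.*-distribˡ-+ 2 1 (i / 2))) (cong (2 ℕ.*_) (sym (half-step i)))))
    (cong -_ s) (trans (half-step (suc i)) (trans (cong suc h) (sym (half-step i))))
  ... | odd e s h = odd
    (trans (cong (λ t → 2 ℕ.+ t) e) (cong suc (trans (sym (ℕₚ.*-distribˡ-+ 2 1 (i / 2))) (cong (2 ℕ.*_) (sym (half-step i))))))
    (cong -_ s) (trans (half-step (suc i)) (cong suc (trans h (sym (half-step i)))))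

  binom-absorb : ∀ n k → suc k ℕ.* binom (suc n) (suc k) ≡ suc n ℕ.* binom n k
  binom-absorb zero    zero    = refl
  binom-absorb zero    (suc k) = ℕₚ.*-zeroʳ (suc k)
  binom-absorb (suc n) zero    = begin
    1 ℕ.* binom (2 ℕ.+ n) 1                            ≡⟨ cong (1 ℕ.*_) (nCk+nC[k+1]≡[n+1]C[k+1] (suc n) 0) ⟨
    1 ℕ.* (1 ℕ.+ binom (suc n) 1)                      ≡⟨ ℕₚ.*-distribˡ-+ 1 1 _ ⟩
    1 ℕ.+ 1 ℕ.* binom (suc n) 1                        ≡⟨ cong suc (binom-absorb n 0) ⟩
    1 ℕ.+ suc n ℕ.* 1                                  ∎
  binom-absorb (suc n) (suc k) = begin
    (2 ℕ.+ k) ℕ.* binom (2 ℕ.+ n) (2 ℕ.+ k)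
      ≡⟨ cong ((2 ℕ.+ k) ℕ.*_) (nCk+nC[k+1]≡[n+1]C[k+1] (suc n) (suc k)) ⟨
    (2 ℕ.+ k) ℕ.* (x ℕ.+ binom (suc n) (2 ℕ.+ k))
      ≡⟨ l₁ k x (binom (suc n) (2 ℕ.+ k)) ⟩
    x ℕ.+ suc k ℕ.* x ℕ.+ (2 ℕ.+ k) ℕ.* binom (suc n) (2 ℕ.+ k)
      ≡⟨ cong₂ (λ s t → x ℕ.+ s ℕ.+ t) (binom-absorb n k) (binom-absorb n (suc k)) ⟩
    x ℕ.+ suc n ℕ.* binom n k ℕ.+ suc n ℕ.* binom n (suc k)
      ≡⟨ l₂ x n (binom n k) (binom n (suc k)) ⟩
    x ℕ.+ suc n ℕ.* (binom n k ℕ.+ binom n (suc k))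
      ≡⟨ cong (λ t → x ℕ.+ suc n ℕ.* t) (nCk+nC[k+1]≡[n+1]C[k+1] n k) ⟩
    (2 ℕ.+ n) ℕ.* x ∎
    where
    x = binom (suc n) (suc k)
    l₁ : ∀ k x y → (2 ℕ.+ k) ℕ.* (x ℕ.+ y) ≡ x ℕ.+ (1 ℕ.+ k) ℕ.* x ℕ.+ (2 ℕ.+ k) ℕ.* y
    l₁ = ℕSolver.solve-∀
    l₂ : ∀ x n y z → x ℕ.+ (1 ℕ.+ n) ℕ.* y ℕ.+ (1 ℕ.+ n) ℕ.* z ≡ x ℕ.+ (1 ℕ.+ n) ℕ.* (y ℕ.+ z)
    l₂ = ℕSolver.solve-∀

  -- The ratio rule (k + 1) C(n, k + 1) = (n - k) C(n, k), freed of subtraction so that k > n is no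
  -- special case.
  binom-step : ∀ n k → suc k ℕ.* binom n (suc k) ℕ.+ k ℕ.* binom n k ≡ n ℕ.* binom n k
  binom-step n k = ℕₚ.+-cancelˡ-≡ (binom n k) _ _ $ begin
    binom n k ℕ.+ (suc k ℕ.* binom n (suc k) ℕ.+ k ℕ.* binom n k)
      ≡⟨ lemma (binom n k) k (binom n (suc k)) ⟩
    suc k ℕ.* (binom n k ℕ.+ binom n (suc k))
      ≡⟨ cong (suc k ℕ.*_) (nCk+nC[k+1]≡[n+1]C[k+1] n k) ⟩
    suc k ℕ.* binom (suc n) (suc k)
      ≡⟨ binom-absorb n k ⟩
    suc n ℕ.* binom n k ∎
    where
    lemma : ∀ x k y → x ℕ.+ ((1 ℕ.+ k) ℕ.* y ℕ.+ k ℕ.* x) ≡ (1 ℕ.+ k) ℕ.* (x ℕ.+ y)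
    lemma = ℕSolver.solve-∀

  binom-stepℤ : ∀ n k → (1ℤ + + k) * + binom n (suc k) + + k * + binom n k ≡ + n * + binom n k
  binom-stepℤ n k = begin
    + suc k * + binom n (suc k) + + k * + binom n k
      ≡⟨ cong₂ _+_ (ℤₚ.pos-* (suc k) _) (ℤₚ.pos-* k _) ⟨
    + (suc k ℕ.* binom n (suc k)) + + (k ℕ.* binom n k)
      ≡⟨ cong +_ (binom-step n k) ⟩
    + (n ℕ.* binom n k)
      ≡⟨ ℤₚ.pos-* n _ ⟩
    + n * + binom n k ∎

  -- Δ shifted by one, with the value 0 that the generating function (1 − x)(1 − x²)^ν has at index −1.
  δ : ℕ → ℕ → ℤ
  δ ν zero    = 0ℤ
  δ ν (suc i) = Δ ν i

  -- The differential equation (1 − x²) F′ = −(1 + (n − 1) x) F of F = (1 − x)(1 − x²)^ν, n = 2ν + 2.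
  δ-recurrence : ∀ ν i →
    (1ℤ + + i) * δ ν (2 ℕ.+ i) + δ ν (1 ℕ.+ i) + (+ 2 + + 2 * + ν - + i) * δ ν i ≡ 0ℤ
  δ-recurrence ν zero    = lemma (+ ν)
    where
    lemma : ∀ ν → (1ℤ + 0ℤ) * -1ℤ + 1ℤ + (+ 2 + + 2 * ν - 0ℤ) * 0ℤ ≡ 0ℤ
    lemma = ℤSolver.solve-∀
  δ-recurrence ν (suc i)
    rewrite Δ-sgn ν (2 ℕ.+ i) | Δ-sgn ν (1 ℕ.+ i) | Δ-sgn ν i | half-step i
    with parityStep i
  ... | even e s h rewrite s | h = begin
    (1ℤ + + suc i) * (- sgn i * y) + - sgn i * x + (+ 2 + + 2 * + ν - + suc i) * (sgn i * x)
      ≡⟨ cong (λ t → (1ℤ + (1ℤ + t)) * (- sgn i * y) + - sgn i * x + (+ 2 + + 2 * + ν - (1ℤ + t)) * (sgn i * x))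
              (trans (cong +_ e) (ℤₚ.pos-* 2 (i / 2))) ⟩
    (1ℤ + (1ℤ + + 2 * k)) * (- sgn i * y) + - sgn i * x + (+ 2 + + 2 * + ν - (1ℤ + + 2 * k)) * (sgn i * x)
      -- With i = 2k everything collapses to a multiple of the defect in `binom-stepℤ`; the odd case
      -- reaches the same expression.
      ≡⟨ lemma k (sgn i) x y (+ ν) ⟩
    + 2 * sgn i * (+ ν * x - ((1ℤ + k) * y + k * x))
      ≡⟨ cong (λ t → + 2 * sgn i * (+ ν * x - t)) (binom-stepℤ ν (i / 2)) ⟩
    + 2 * sgn i * (+ ν * x - + ν * x)
      ≡⟨ cong (+ 2 * sgn i *_) (ℤₚ.+-inverseʳ (+ ν * x)) ⟩
    + 2 * sgn i * 0ℤ
      ≡⟨ ℤₚ.*-zeroʳ (+ 2 * sgn i) ⟩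
    0ℤ ∎
    where
    k = + (i / 2)
    x = + binom ν (i / 2)
    y = + binom ν (suc (i / 2))
    lemma : ∀ k s x y ν →
      (1ℤ + (1ℤ + + 2 * k)) * (- s * y) + - s * x + (+ 2 + + 2 * ν - (1ℤ + + 2 * k)) * (s * x)
      ≡ + 2 * s * (ν * x - ((1ℤ + k) * y + k * x))
    lemma = ℤSolver.solve-∀
  ... | odd e s h rewrite s | h = begin
    (1ℤ + + suc i) * (- sgn i * y) + sgn i * y + (+ 2 + + 2 * + ν - + suc i) * (sgn i * x)
      ≡⟨ cong (λ t → (1ℤ + (1ℤ + t)) * (- sgn i * y) + sgn i * y + (+ 2 + + 2 * + ν - (1ℤ + t)) * (sgn i * x))
              (trans (cong +_ e) (cong (λ t → 1ℤ + t) (ℤₚ.pos-* 2 (i / 2)))) ⟩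
    (1ℤ + (1ℤ + (1ℤ + + 2 * k))) * (- sgn i * y) + sgn i * y + (+ 2 + + 2 * + ν - (1ℤ + (1ℤ + + 2 * k))) * (sgn i * x)
      ≡⟨ lemma k (sgn i) x y (+ ν) ⟩
    + 2 * sgn i * (+ ν * x - ((1ℤ + k) * y + k * x))
      ≡⟨ cong (λ t → + 2 * sgn i * (+ ν * x - t)) (binom-stepℤ ν (i / 2)) ⟩
    + 2 * sgn i * (+ ν * x - + ν * x)
      ≡⟨ cong (+ 2 * sgn i *_) (ℤₚ.+-inverseʳ (+ ν * x)) ⟩
    + 2 * sgn i * 0ℤ
      ≡⟨ ℤₚ.*-zeroʳ (+ 2 * sgn i) ⟩
    0ℤ ∎
    where
    k = + (i / 2)
    x = + binom ν (i / 2)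
    y = + binom ν (suc (i / 2))
    lemma : ∀ k s x y ν →
      (1ℤ + (1ℤ + (1ℤ + + 2 * k))) * (- s * y) + s * y + (+ 2 + + 2 * ν - (1ℤ + (1ℤ + + 2 * k))) * (s * x)
      ≡ + 2 * s * (ν * x - ((1ℤ + k) * y + k * x))
    lemma = ℤSolver.solve-∀

  -- Coupled recurrences and their explicit solution.

  -- The homogeneous equation Bu = v seen through sphere sums around a centre: `start` is its value
  -- there, `step` its sum at distance i + 1, as in `sphere-ball`.
  record Coupled (n : ℤ) (u v : ℕ → ℤ) : Set where
    field
      start : u 0 + u 1 ≡ v 0
      step  : ∀ i → v (1 ℕ.+ i) + + i * u i ≡ u (1 ℕ.+ i) + n * u i + (+ (2 ℕ.+ i)) * u (2 ℕ.+ i)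

  open Coupled

  Coupled-next : ∀ {n u v u′ v′} → Coupled n u v → Coupled n u′ v′ → ∀ i →
    u i ≡ u′ i → u (1 ℕ.+ i) ≡ u′ (1 ℕ.+ i) → v (1 ℕ.+ i) ≡ v′ (1 ℕ.+ i) → u (2 ℕ.+ i) ≡ u′ (2 ℕ.+ i)
  Coupled-next {n} {u} {v} {u′} {v′} c c′ i e₀ e₁ e₂ =
    ℤₚ.*-cancelˡ-≡ (+ (2 ℕ.+ i)) (u (2 ℕ.+ i)) (u′ (2 ℕ.+ i)) $
    ℤ-Group.∙-cancelˡ (u (1 ℕ.+ i) + n * u i) _ _ $ begin
      u (1 ℕ.+ i) + n * u i + + (2 ℕ.+ i) * u (2 ℕ.+ i)     ≡⟨ step c i ⟨
      v (1 ℕ.+ i) + + i * u i                               ≡⟨ cong₂ (λ s t → s + + i * t) e₂ e₀ ⟩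
      v′ (1 ℕ.+ i) + + i * u′ i                             ≡⟨ step c′ i ⟩
      u′ (1 ℕ.+ i) + n * u′ i + + (2 ℕ.+ i) * u′ (2 ℕ.+ i)
        ≡⟨ cong₂ (λ s t → s + n * t + + (2 ℕ.+ i) * u′ (2 ℕ.+ i)) e₁ e₀ ⟨
      u (1 ℕ.+ i) + n * u i + + (2 ℕ.+ i) * u′ (2 ℕ.+ i)    ∎

  Coupled-one : ∀ {n u v u′ v′} → Coupled n u v → Coupled n u′ v′ → u 0 ≡ u′ 0 → v 0 ≡ v′ 0 → u 1 ≡ u′ 1
  Coupled-one {u = u} {v} {u′} {v′} c c′ e f = ℤ-Group.∙-cancelˡ (u 0) _ _ $ begin
    u 0 + u 1    ≡⟨ start c ⟩
    v 0          ≡⟨ f ⟩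
    v′ 0         ≡⟨ start c′ ⟨
    u′ 0 + u′ 1  ≡⟨ cong (_+ u′ 1) e ⟨
    u 0 + u′ 1   ∎

  -- The recurrences have order two, but `start` supplies the values at 1, and the leading
  -- coefficient 2 + i can be cancelled.
  Coupled-unique : ∀ {n u v u′ v′} → Coupled n u v → Coupled n v u → Coupled n u′ v′ → Coupled n v′ u′ →
    u 0 ≡ u′ 0 → v 0 ≡ v′ 0 → ∀ i → u i ≡ u′ i × v i ≡ v′ i
  Coupled-unique {u = u} {v} {u′} {v′} uv vu uv′ vu′ e f i = proj₁ (go i)
    where
    Agree : ℕ → Set
    Agree i = u i ≡ u′ i × v i ≡ v′ i
    go : ∀ i → Agree i × Agree (suc i)
    go zero    = (e , f) , (Coupled-one uv uv′ e f , Coupled-one vu vu′ f e)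
    go (suc i) with go i
    ... | (e₀ , f₀) , (e₁ , f₁) = (e₁ , f₁) ,
      (Coupled-next uv uv′ i e₀ e₁ f₁ , Coupled-next vu vu′ i f₀ f₁ e₁)

  module _ (ν : ℕ) where
    N : ℤ
    N = 1ℤ + + 2 * + ν

    -- With F the generating function of `Δ ν`, these are the coefficients of (N - x) F and (N x -
    -- 1) F: the combinations of (1 + x) F and (1 - x) F with constant terms N and -1.
    α β : ℕ → ℤ
    α i = N * δ ν (suc i) - δ ν i
    β i = N * δ ν i - δ ν (suc i)

    residual : ℕ → ℤ
    residual i = (1ℤ + + i) * δ ν (2 ℕ.+ i) + δ ν (1 ℕ.+ i) + (+ 2 + + 2 * + ν - + i) * δ ν i

    vanish : ∀ x i j → x + (N * residual i - residual j) ≡ x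
    vanish x i j = begin
      x + (N * residual i - residual j)
        ≡⟨ cong₂ (λ s t → x + (N * s - t)) (δ-recurrence ν i) (δ-recurrence ν j) ⟩
      x + (N * 0ℤ - 0ℤ)
        ≡⟨ lemma x N ⟩
      x ∎
      where
      lemma : ∀ x n → x + (n * 0ℤ - 0ℤ) ≡ x
      lemma = ℤSolver.solve-∀

    αβ-Coupled : Coupled (1ℤ + N) α β
    αβ-Coupled .start = lemma (+ ν)
      where
      lemma : ∀ ν → ((1ℤ + + 2 * ν) * 1ℤ - 0ℤ) + ((1ℤ + + 2 * ν) * -1ℤ - 1ℤ) ≡ (1ℤ + + 2 * ν) * 0ℤ - 1ℤ
      lemma = ℤSolver.solve-∀
    αβ-Coupled .step i = begin
      β (1 ℕ.+ i) + + i * α i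
        -- The two sides of `step` differ by this combination of residuals, built like `α` itself;
        -- adding it leaves a polynomial identity in four free values of `δ`.
        ≡⟨ vanish _ (suc i) i ⟨
      β (1 ℕ.+ i) + + i * α i + (N * residual (suc i) - residual i)
        ≡⟨ lemma (+ i) (+ ν) (δ ν i) (δ ν (1 ℕ.+ i)) (δ ν (2 ℕ.+ i)) (δ ν (3 ℕ.+ i)) ⟩
      α (1 ℕ.+ i) + (1ℤ + N) * α i + + (2 ℕ.+ i) * α (2 ℕ.+ i) ∎
      where
      lemma : ∀ i ν d₀ d₁ d₂ d₃ → let n = 1ℤ + + 2 * ν in
        (n * d₁ - d₂) + i * (n * d₁ - d₀) +
          (n * ((1ℤ + (1ℤ + i)) * d₃ + d₂ + (+ 2 + + 2 * ν - (1ℤ + i)) * d₁)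
             - ((1ℤ + i) * d₂ + d₁ + (+ 2 + + 2 * ν - i) * d₀))
        ≡ (n * d₂ - d₁) + (1ℤ + n) * (n * d₁ - d₀) + (+ 2 + i) * (n * d₃ - d₂)
      lemma = ℤSolver.solve-∀

    βα-Coupled : Coupled (1ℤ + N) β α
    βα-Coupled .start = lemma (+ ν)
      where
      lemma : ∀ ν → ((1ℤ + + 2 * ν) * 0ℤ - 1ℤ) + ((1ℤ + + 2 * ν) * 1ℤ - -1ℤ) ≡ (1ℤ + + 2 * ν) * 1ℤ - 0ℤ
      lemma = ℤSolver.solve-∀
    βα-Coupled .step i = begin
      α (1 ℕ.+ i) + + i * β i
        ≡⟨ vanish _ i (suc i) ⟨
      α (1 ℕ.+ i) + + i * β i + (N * residual i - residual (suc i))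
        ≡⟨ lemma (+ i) (+ ν) (δ ν i) (δ ν (1 ℕ.+ i)) (δ ν (2 ℕ.+ i)) (δ ν (3 ℕ.+ i)) ⟩
      β (1 ℕ.+ i) + (1ℤ + N) * β i + + (2 ℕ.+ i) * β (2 ℕ.+ i) ∎
      where
      lemma : ∀ i ν d₀ d₁ d₂ d₃ → let n = 1ℤ + + 2 * ν in
        (n * d₂ - d₁) + i * (n * d₀ - d₁) +
          (n * ((1ℤ + i) * d₂ + d₁ + (+ 2 + + 2 * ν - i) * d₀)
             - ((1ℤ + (1ℤ + i)) * d₃ + d₂ + (+ 2 + + 2 * ν - (1ℤ + i)) * d₁))
        ≡ (n * d₁ - d₂) + (1ℤ + n) * (n * d₀ - d₁) + (+ 2 + i) * (n * d₂ - d₃)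
      lemma = ℤSolver.solve-∀

-- Distance distributions of a coupled pair.

module Distribution where
  open ≡-Reasoning
  open Counting
  open Signs

  -- These are the sphere sums of n g - 1. If Bg = 1 + h, then B(n g - 1) = n h - 1, so the constant
  -- term disappears.
  normalised : ∀ {n} → (Word n → ℕ) → Word n → ℕ → ℤ
  normalised {n} g c i = + n * + sphere i g c - + binom n i

  normalised-Coupled : ∀ {n} {g h : Word n → ℕ} → (∀ w → ball g w ≡ 1 ℕ.+ h w) → ∀ c →
                       Coupled (+ n) (normalised g c) (normalised h c)
  normalised-Coupled {n} {g} {h} e c .Coupled.start = begin
    (+ n * + g c - 1ℤ) + (+ n * + sphere 1 g c - + binom n 1)
      ≡⟨ cong (λ t → (+ n * + g c - 1ℤ) + (+ n * + sphere 1 g c - + t)) (nC1≡n n) ⟩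
    (+ n * + g c - 1ℤ) + (+ n * + sphere 1 g c - + n)
      ≡⟨ l₁ (+ n) (+ g c) (+ sphere 1 g c) ⟩
    + n * (+ g c + + sphere 1 g c) - (1ℤ + + n)
      ≡⟨ cong (λ t → + n * + t - (1ℤ + + n)) (e c) ⟩
    + n * (1ℤ + + h c) - (1ℤ + + n)
      ≡⟨ l₂ (+ n) (+ h c) ⟩
    + n * + h c - 1ℤ ∎
    where
    l₁ : ∀ n x y → (n * x - 1ℤ) + (n * y - n) ≡ n * (x + y) - (1ℤ + n)
    l₁ = ℤSolver.solve-∀
    l₂ : ∀ n x → n * (1ℤ + x) - (1ℤ + n) ≡ n * x - 1ℤ
    l₂ = ℤSolver.solve-∀
  normalised-Coupled {n} {g} {h} e c .Coupled.step i = begin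
    (+ n * h₁ - b₁) + + i * (+ n * g₀ - b₀)
      ≡⟨ l₁ (+ n) (+ i) g₀ h₁ b₀ b₁ ⟩
    + n * (b₁ + h₁ + + i * g₀) - ((1ℤ + + n) * b₁ + + i * b₀)
      ≡⟨ cong₂ (λ s t → + n * s - t) sphereℤ binomℤ ⟩
    + n * (g₁ + + n * g₀ + (+ 2 + + i) * g₂) - (b₁ + + n * b₀ + (+ 2 + + i) * b₂)
      ≡⟨ l₂ (+ n) (+ i) g₀ g₁ g₂ b₀ b₁ b₂ ⟩
    (+ n * g₁ - b₁) + + n * (+ n * g₀ - b₀) + (+ 2 + + i) * (+ n * g₂ - b₂) ∎
    where
    g₀ = + sphere i g c
    g₁ = + sphere (1 ℕ.+ i) g c
    g₂ = + sphere (2 ℕ.+ i) g c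
    h₁ = + sphere (1 ℕ.+ i) h c
    b₀ = + binom n i
    b₁ = + binom n (1 ℕ.+ i)
    b₂ = + binom n (2 ℕ.+ i)
    cast : ∀ x y k z → + (x ℕ.+ n ℕ.* y ℕ.+ k ℕ.* z) ≡ + x + + n * + y + + k * + z
    cast x y k z = cong₂ (λ s t → + x + s + t) (ℤₚ.pos-* n y) (ℤₚ.pos-* k z)
    sphereℤ : b₁ + h₁ + + i * g₀ ≡ g₁ + + n * g₀ + (+ 2 + + i) * g₂
    sphereℤ = begin
      b₁ + h₁ + + i * g₀
        ≡⟨ cong (λ t → b₁ + h₁ + t) (ℤₚ.pos-* i (sphere i g c)) ⟨
      + (binom n (1 ℕ.+ i) ℕ.+ sphere (1 ℕ.+ i) h c ℕ.+ i ℕ.* sphere i g c)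
        ≡⟨ cong +_ (sphere-recurrence e i c) ⟩
      + (sphere (1 ℕ.+ i) g c ℕ.+ n ℕ.* sphere i g c ℕ.+ (2 ℕ.+ i) ℕ.* sphere (2 ℕ.+ i) g c)
        ≡⟨ cast (sphere (1 ℕ.+ i) g c) (sphere i g c) (2 ℕ.+ i) (sphere (2 ℕ.+ i) g c) ⟩
      g₁ + + n * g₀ + (+ 2 + + i) * g₂ ∎
    binomℤ : (1ℤ + + n) * b₁ + + i * b₀ ≡ b₁ + + n * b₀ + (+ 2 + + i) * b₂
    binomℤ = begin
      (1ℤ + + n) * b₁ + + i * b₀
        ≡⟨ cong₂ _+_ (ℤₚ.pos-* (1 ℕ.+ n) (binom n (1 ℕ.+ i))) (ℤₚ.pos-* i (binom n i)) ⟨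
      + ((1 ℕ.+ n) ℕ.* binom n (1 ℕ.+ i) ℕ.+ i ℕ.* binom n i)
        ≡⟨ cong +_ (binom-recurrence n i) ⟩
      + (binom n (1 ℕ.+ i) ℕ.+ n ℕ.* binom n i ℕ.+ (2 ℕ.+ i) ℕ.* binom n (2 ℕ.+ i))
        ≡⟨ cast (binom n (1 ℕ.+ i)) (binom n i) (2 ℕ.+ i) (binom n (2 ℕ.+ i)) ⟩
      b₁ + + n * b₀ + (+ 2 + + i) * b₂ ∎
    l₁ : ∀ n i g₀ h₁ b₀ b₁ → (n * h₁ - b₁) + i * (n * g₀ - b₀) ≡
         n * (b₁ + h₁ + i * g₀) - ((1ℤ + n) * b₁ + i * b₀)
    l₁ = ℤSolver.solve-∀
    l₂ : ∀ n i g₀ g₁ g₂ b₀ b₁ b₂ →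
      n * (g₁ + n * g₀ + (+ 2 + i) * g₂) - (b₁ + n * b₀ + (+ 2 + i) * b₂) ≡
      (n * g₁ - b₁) + n * (n * g₀ - b₀) + (+ 2 + i) * (n * g₂ - b₂)
    l₂ = ℤSolver.solve-∀

  distribution : ∀ {n ν} {g h : Word n → ℕ} → n ≡ 2 ℕ.+ 2 ℕ.* ν →
    (∀ w → ball g w ≡ 1 ℕ.+ h w) → (∀ w → ball h w ≡ 1 ℕ.+ g w) →
    ∀ c → g c ≡ 1 → h c ≡ 0 → ∀ i →
    + n * + sphere i g c ≡ + binom n i + + (n ∸ 1) * δ ν (suc i) - δ ν i ×
    + n * + sphere i h c ≡ + binom n i + + (n ∸ 1) * δ ν i - δ ν (suc i)
  distribution {ν = ν} {g} {h} refl eg eh c gc hc i =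
    solve (δ ν (suc i)) (δ ν i) (proj₁ (agree i)) , solve (δ ν i) (δ ν (suc i)) (proj₂ (agree i))
    where
    n = 2 ℕ.+ 2 ℕ.* ν
    N≡ : + (n ∸ 1) ≡ N ν
    N≡ = cong (λ t → 1ℤ + t) (ℤₚ.pos-* 2 ν)
    1+N≡ : 1ℤ + N ν ≡ + n
    1+N≡ = cong (λ t → 1ℤ + t) (sym N≡)
    agree : ∀ i → normalised g c i ≡ α ν i × normalised h c i ≡ β ν i
    agree = Coupled-unique (normalised-Coupled eg c) (normalised-Coupled eh c)
      (subst (λ t → Coupled t (α ν) (β ν)) 1+N≡ (αβ-Coupled ν))
      (subst (λ t → Coupled t (β ν) (α ν)) 1+N≡ (βα-Coupled ν))
      -- The normalised pair starts at n - 1 and -1, matching `α` and `β` since `δ` begins with 0,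
      -- 1.
      (begin
        + n * + g c - 1ℤ       ≡⟨ cong₂ (λ s t → s * + t - 1ℤ) (sym 1+N≡) gc ⟩
        (1ℤ + N ν) * 1ℤ - 1ℤ   ≡⟨ l₁ (N ν) ⟩
        N ν * 1ℤ - 0ℤ          ∎)
      (begin
        + n * + h c - 1ℤ       ≡⟨ cong₂ (λ s t → s * + t - 1ℤ) (sym 1+N≡) hc ⟩
        (1ℤ + N ν) * 0ℤ - 1ℤ   ≡⟨ l₂ (N ν) ⟩
        N ν * 0ℤ - 1ℤ          ∎)
      where
      l₁ : ∀ n → (1ℤ + n) * 1ℤ - 1ℤ ≡ n * 1ℤ - 0ℤ
      l₁ = ℤSolver.solve-∀
      l₂ : ∀ n → (1ℤ + n) * 0ℤ - 1ℤ ≡ n * 0ℤ - 1ℤ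
      l₂ = ℤSolver.solve-∀
    solve : ∀ {x b} d d′ → x - b ≡ N ν * d - d′ → x ≡ b + + (n ∸ 1) * d - d′
    solve {x} {b} d d′ e = begin
      x                         ≡⟨ l₁ x b ⟩
      b + (x - b)               ≡⟨ cong (λ t → b + t) e ⟩
      b + (N ν * d - d′)        ≡⟨ ℤₚ.+-assoc b _ _ ⟨
      b + N ν * d - d′          ≡⟨ cong (λ t → b + t * d - d′) N≡ ⟨
      b + + (n ∸ 1) * d - d′    ∎
      where
      l₁ : ∀ x b → x ≡ b + (x - b)
      l₁ = ℤSolver.solve-∀

-- Length a power of two, and the two kinds of centre.

module NP1CCCode (r : ℕ) (2≤r : 2 ≤ r) (D : Code (2 ^ r)) (np : NP1CC r D) where
  open import Data.Nat using () renaming (_+_ to _⊹_; _*_ to _⋆_)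
  open Counting
  open ≡-Reasoning

  ν : ℕ
  ν = 2 ^ (r ∸ 1) ∸ 1

  length≡ : ∀ r → 2 ≤ r → 2 ^ r ≡ 2 ⊹ 2 ⋆ (2 ^ (r ∸ 1) ∸ 1)
  length≡ (suc r) _ = trans (cong (2 ⋆_) (sym (ℕₚ.m+[n∸m]≡n (ℕₚ.m^n>0 2 r)))) (ℕₚ.*-distribˡ-+ 2 1 (2 ^ r ∸ 1))

  3∤2^ : ∀ k → ¬ 3 ∣ 2 ^ k
  3∤2^ zero    = from-no (3 ∣? 1)
  3∤2^ (suc k) d with euclidsLemma 2 (2 ^ k) (from-yes (prime? 3)) d
  ... | inj₁ d′ = from-no (3 ∣? 2) d′
  ... | inj₂ d′ = 3∤2^ k d′

  n≤2^n : ∀ n → n ≤ 2 ^ n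
  n≤2^n zero    = z≤n
  n≤2^n (suc n) = ℕₚ.≤-trans (ℕₚ.+-mono-≤ (ℕₚ.m^n>0 2 n) (n≤2^n n))
                             (ℕₚ.+-monoʳ-≤ (2 ^ n) (ℕₚ.m≤m+n (2 ^ n) 0))

  size≡ : 2 ^ r ⋆ total (indicator ∘ D) ≡ 2 ^ (2 ^ r)
  size≡ = begin
    2 ^ r ⋆ total (indicator ∘ D)  ≡⟨ cong (2 ^ r ⋆_) (trans (sym (size-total D)) (proj₁ np)) ⟩
    2 ^ r ⋆ 2 ^ (2 ^ r ∸ r)        ≡⟨ ℕₚ.^-distribˡ-+-* 2 r _ ⟨
    2 ^ (r ⊹ (2 ^ r ∸ r))          ≡⟨ cong (2 ^_) (ℕₚ.m+[n∸m]≡n (n≤2^n r)) ⟩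
    2 ^ (2 ^ r)                    ∎

  cover : ∀ x → 1 ≤ ball (indicator ∘ D) x
  cover x with proj₂ np x
  ... | c , c∈D , inj₁ e = ℕₚ.≤-trans (ℕₚ.≤-reflexive (sym (cong indicator c∈D)))
    (ℕₚ.≤-trans (sphere-lower′ (indicator ∘ D) x c e) (ℕₚ.m≤m+n _ _))
  ... | c , c∈D , inj₂ e = ℕₚ.≤-trans (ℕₚ.≤-reflexive (sym (cong indicator c∈D)))
    (ℕₚ.≤-trans (sphere-lower′ (indicator ∘ D) x c e) (ℕₚ.m≤n+m _ _))

  open NearlyPerfect {ν = ν} D (length≡ r 2≤r)
    (3∤2^ (r ⊹ r) ∘ subst (3 ∣_) (sym (ℕₚ.^-distribˡ-+-* 2 r r))) size≡ cover public

  -- The ball around `c` holds one codeword, so its excess is 0. The radius is a successor so that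
  -- both values of `δ` unfold to `Δ`.
  lonely-centre : ∀ c → χ c ≡ 1 → sphere 1 χ c ≡ 0 → ∀ i →
    + (2 ^ r) * + sphere (suc i) χ c ≡ + binom (2 ^ r) (suc i) + + (2 ^ r ∸ 1) * Δ ν (suc i) - Δ ν i
  lonely-centre c on a₁ i = proj₁ (Distribution.distribution {ν = ν} (length≡ r 2≤r) ball-χ ball-excess≡ c on
    (ℕₚ.suc-injective (trans (sym (ball-χ c)) (cong₂ _⊹_ on a₁))) (suc i))

  -- No ball holds more than two codewords, so two neighbours in the code exhaust it: `c` itself is
  -- outside and has excess 1.
  module TwoNeighbours (c : Word (2 ^ r)) (two : 2 ≤ sphere 1 χ c) where
    ball≤2 : χ c ⊹ sphere 1 χ c ≤ 2
    ball≤2 with excess c | ball-χ c | excess≤1 c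
    ... | _ | e | inj₁ refl = ℕₚ.≤-trans (ℕₚ.≤-reflexive e) (s≤s z≤n)
    ... | _ | e | inj₂ refl = ℕₚ.≤-reflexive e

    a₁ : sphere 1 χ c ≡ 2
    a₁ = ℕₚ.≤-antisym (ℕₚ.≤-trans (ℕₚ.m≤n+m _ (χ c)) ball≤2) two

    a₀ : χ c ≡ 0
    a₀ = ℕₚ.n≤0⇒n≡0 (ℕₚ.+-cancelʳ-≤ 2 (χ c) 0 (subst (λ t → χ c ⊹ t ≤ 2) a₁ ball≤2))

    φ₀ : excess c ≡ 1
    φ₀ = ℕₚ.suc-injective (trans (sym (ball-χ c)) (cong₂ _⊹_ a₀ a₁))

    distribution : ∀ i →
      + (2 ^ r) * + sphere (2 ⊹ i) χ c ≡ + binom (2 ^ r) (2 ⊹ i) + + (2 ^ r ∸ 1) * Δ ν (suc i) - Δ ν (2 ⊹ i)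
    distribution i = proj₂ (Distribution.distribution {ν = ν} (length≡ r 2≤r) ball-excess≡ ball-χ c φ₀ a₀ (2 ⊹ i))

theorem5 : (r : ℕ) → 2 ≤ r →
    let n = 2 ^ r
        ν = 2 ^ (r ∸ 1) ∸ 1
    in ((C : Code n) → NP1CC r C → Zeroed C →
          (TypeB C ⊎ (TypeC C × ∃ λ (w : Word n) → w ∈C C × weight w ≡ 2)) →
          (A 0 C ≡ 1)
          × (∀ i → 1 ≤ i → i ≤ n →
               + n * + (A i C) ≡ + (binom n i) + (+ (n ∸ 1)) * Δ ν i - Δ ν (i ∸ 1)))
     × ((C D : Code n) → NP1CC r D → (TypeB D ⊎ TypeC D) → IsTranslate C D →
          (Σ (Word n) λ u → Σ (Word n) λ v →
             u ∈C C × v ∈C C × u ≢ v × weight u ≡ 1 × weight v ≡ 1) →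
          (A 0 C ≡ 0) × (A 1 C ≡ 2)
          × (∀ i → 2 ≤ i →
               + n * + (A i C) ≡ + (binom n i) + (+ (n ∸ 1)) * Δ ν (i ∸ 1) - Δ ν i))
theorem5 r 2≤r = zeroed , translated
  where
  open Counting
  n = 2 ^ r
  ν = 2 ^ (r ∸ 1) ∸ 1

  zeroed : (C : Code n) → NP1CC r C → Zeroed C →
    (TypeB C ⊎ (TypeC C × ∃ λ (w : Word n) → w ∈C C × weight w ≡ 2)) →
    (A 0 C ≡ 1)
    × (∀ i → 1 ≤ i → i ≤ n →
         + n * + (A i C) ≡ + (binom n i) + (+ (n ∸ 1)) * Δ ν i - Δ ν (i ∸ 1))
  zeroed C np 0∈C types = trans (A-sphere 0 C) on , formula
    where
    open NP1CCCode r 2≤r C np hiding (ν)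
    on : χ zeroWord ≡ 1
    on = cong indicator 0∈C
    a₁ : (TypeB C ⊎ (TypeC C × ∃ λ (w : Word n) → w ∈C C × weight w ≡ 2)) → sphere 1 χ zeroWord ≡ 0
    a₁ (inj₁ typeB) = sphere-zero 1 χ zeroWord off
      where
      off : ∀ w → dist zeroWord w ≡ 1 → χ w ≡ 0
      off w d with C w in w∈C
      ... | false = refl
      -- A codeword of weight one would be a partner of the zero word at distance 1, where Type B
      -- demands 2.
      ... | true  = contradiction (trans (sym d) (typeB zeroWord w 0∈C (w∈C , w≢0 , inj₁ d))) λ ()
        where
        w≢0 : w ≢ zeroWord
        w≢0 refl = contradiction (trans (sym d) (dist-self w)) λ ()
    -- The codeword of weight two already accounts for all of `near zeroWord`, which is 1.
    a₁ (inj₂ (_ , w , w∈C , wt)) = ℕₚ.n≤0⇒n≡0 $ ℕₚ.+-cancelʳ-≤ 1 (sphere 1 χ zeroWord) 0 $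
      ℕₚ.≤-trans (ℕₚ.+-monoʳ-≤ (sphere 1 χ zeroWord) a₂) (ℕₚ.≤-reflexive (near≡1 zeroWord on))
      where
      a₂ : 1 ≤ sphere 2 χ zeroWord
      a₂ = subst (_≤ sphere 2 χ zeroWord) (cong indicator w∈C)
             (sphere-lower′ χ zeroWord w (trans (dist-zeroWord w) wt))
    formula : ∀ i → 1 ≤ i → i ≤ n →
      + n * + (A i C) ≡ + (binom n i) + (+ (n ∸ 1)) * Δ ν i - Δ ν (i ∸ 1)
    formula (suc i) _ _ rewrite A-sphere (suc i) C = lonely-centre zeroWord on (a₁ types) i

  translated : (C D : Code n) → NP1CC r D → (TypeB D ⊎ TypeC D) → IsTranslate C D →
    (Σ (Word n) λ u → Σ (Word n) λ v →
       u ∈C C × v ∈C C × u ≢ v × weight u ≡ 1 × weight v ≡ 1) →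
    (A 0 C ≡ 0) × (A 1 C ≡ 2)
    × (∀ i → 2 ≤ i →
         + n * + (A i C) ≡ + (binom n i) + (+ (n ∸ 1)) * Δ ν (i ∸ 1) - Δ ν i)
  translated C D np _ (x , C≡D) (u , v , u∈C , v∈C , u≢v , wu , wv) =
    trans (A-χ 0) a₀ , trans (A-χ 1) a₁ , formula
    where
    open NP1CCCode r 2≤r D np hiding (ν)
    -- Weights in `C` are distances in `D` from the shifted zero word.
    centre = zeroWord ⊕ x
    sphere-C : ∀ i → sphere i (indicator ∘ C) zeroWord ≡ sphere i χ centre
    sphere-C i = trans (sphere-cong i (cong indicator ∘ C≡D) zeroWord) (sphere-shift i χ zeroWord x)
    A-χ : ∀ i → A i C ≡ sphere i χ centre
    A-χ i = trans (A-sphere i C) (sphere-C i)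
    two : 2 ≤ sphere 1 χ centre
    two = subst₂ _≤_ (cong₂ ℕ._+_ (cong indicator u∈C) (cong indicator v∈C)) (sphere-C 1)
      (sphere-lower₂ (indicator ∘ C) zeroWord u v u≢v
        (trans (dist-zeroWord u) wu) (trans (dist-zeroWord v) wv))
    open TwoNeighbours centre two
    formula : ∀ i → 2 ≤ i →
      + n * + (A i C) ≡ + (binom n i) + (+ (n ∸ 1)) * Δ ν (i ∸ 1) - Δ ν i
    formula (suc (suc i)) _ rewrite A-χ (2 ℕ.+ i) = distribution i
    formula (suc zero) (s≤s ())
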